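{- For all $k\ge1$ and $n\ge2$, the map $\psi$ restricts to a bijection between the set of $k$-terminal chord diagrams of size $n$ and the set of $(k-1)$-terminal chord diagrams of size $n-1$.
   Context: A chord diagram of size $n$ is a perfect matching of $\{1,\dots,2n\}$; chords are ordered pairs $(a,b)$ with $a<b$, $a$ the source and $b$ the sink. For chords $c_1=(a_1,b_1)$, $c_2=(a_2,b_2)$ with $a_1<a_2$, they cross if $a_2<b_1<b_2$, and then $c_2$ is a right neighbor of $c_1$. A chord is $j$-terminal if it has at most $j-1$ right neighbors; terminal means 1-terminal. A diagram is $k$-terminal if, for all $1\le j\le k$, there is no $j$-terminal chord before the $j$th-to-last chord in the order of sources (so every diagram is $0$-terminal, and every $k$-terminal diagram with $k\ge1$ is 1-terminal). The map $\psi$ from 1-terminal diagrams of size $n$ to diagrams of size $n-1$ ($n\ge 2$): let $T$ be 1-terminal with chords $c_1<\dots<c_n$ ordered by source. The source-sink group of a chord $c$ consists of the source of $c$ together with the maximal run of consecutive sinks immediately following it (excluding the sink of $c$ itself). Then $\psi(T)$ is obtained from $T$ by (1) moving each source to the end of its source-sink group (all other endpoints keeping their relative order and every source staying paired with its sink), and (2) deleting the terminal chord $c_n$; endpoints are then relabelled order-preservingly. -}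

module Defs where

open import Data.Bool.Base using (if_then_else_; true; false)
open import Data.Fin.Base using (Fin; zero; _<_)
open import Data.Fin.Properties using (_≟_; _<?_)
open import Data.List.Base using (List; []; _∷_; allFin; filter; last; length; lookup)
open import Data.List.Membership.Propositional using (_∈_)
open import Data.List.Membership.Propositional.Properties
  using (∈-allFin; ∈-filter⁺; ∈-filter⁻; ∈-lookup)
open import Data.List.Properties using (length-tabulate; filter-all)
open import Data.List.Relation.Binary.Permutation.Propositional
  using (_↭_; ↭-refl; ↭-sym; ↭-trans; ↭⇒↭ₛ; prep; swap)
open import Data.List.Relation.Binary.Permutation.Propositional.Properties
  using (∈-resp-↭; ↭-length)
open import Data.List.Relation.Binary.Permutation.Setoid.Properties using (Unique-resp-↭)
import Data.List.Relation.Unary.All as All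
open import Data.List.Relation.Unary.AllPairs using (_∷_)
open import Data.List.Relation.Unary.Any using (here; there; index)
open import Data.List.Relation.Unary.Any.Properties using (lookup-index)
open import Data.List.Relation.Unary.Unique.Propositional using (Unique)
import Data.List.Relation.Unary.Unique.Propositional.Properties as Unique
open import Data.Maybe.Base using (fromMaybe)
open import Data.Nat.Base using (ℕ; suc; _*_; _∸_; _≤_)
open import Data.Nat.Properties using (suc-injective; *-suc)
open import Data.Product.Base using (∃-syntax; _×_; _,_; proj₁; proj₂)
open import Function.Base using (_∘_; id)
open import Level using (0ℓ)
open import Relation.Binary.Bundles using (Setoid)
open import Relation.Binary.PropositionalEquality
  using (_≡_; _≢_; refl; sym; trans; cong; setoid)
open import Relation.Nullary.Decidable using (Dec; does; yes; no; _×-dec_; ¬?)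
open import Relation.Nullary.Negation using (¬_; contradiction)

------------------------------------------------------------------------
-- Chord diagrams

-- A perfect matching is given by the map sending every point to the
-- point it is matched with.
record PerfectMatching (m : ℕ) : Set where
  field
    partner            : Fin m → Fin m
    partner-involutive : ∀ p → partner (partner p) ≡ p
    partner-irrefl     : ∀ p → partner p ≢ p

open PerfectMatching public

-- The points 1,…,2n are represented by 0,…,2n-1.
ChordDiagram : ℕ → Set
ChordDiagram n = PerfectMatching (2 * n)

infix 4 _≈_

_≈_ : ∀ {m} → PerfectMatching m → PerfectMatching m → Set
T ≈ U = ∀ p → partner T p ≡ partner U p

module _ {m : ℕ} (T : PerfectMatching m) where

  IsSource : Fin m → Set
  IsSource p = p < partner T p

  IsSink : Fin m → Set
  IsSink p = partner T p < p

  isSource? : ∀ p → Dec (IsSource p)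
  isSource? p = p <? partner T p

  isSink? : ∀ p → Dec (IsSink p)
  isSink? p = partner T p <? p

  -- A chord (a , b) is named by its source a, so that b = partner T a and
  -- the order of sources is _<_.  The list is increasing.
  sources : List (Fin m)
  sources = filter isSource? (allFin m)

  -- The chord with source a₂ crosses the chord with source a₁ and is a
  -- right neighbor of it: a₁ < a₂ < b₁ < b₂.
  IsRightNeighbor : Fin m → Fin m → Set
  IsRightNeighbor a₁ a₂ = a₁ < a₂ × a₂ < partner T a₁ × partner T a₁ < partner T a₂

  isRightNeighbor? : ∀ a₁ a₂ → Dec (IsRightNeighbor a₁ a₂)
  isRightNeighbor? a₁ a₂ =
    a₁ <? a₂ ×-dec a₂ <? partner T a₁ ×-dec partner T a₁ <? partner T a₂

  rightNeighbors : Fin m → List (Fin m)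
  rightNeighbors a = filter (isRightNeighbor? a) sources

  -- Only used for j ≥ 1.
  TerminalChord : ℕ → Fin m → Set
  TerminalChord j a = length (rightNeighbors a) ≤ j ∸ 1

  -- The chord with source d is the j-th to last one: exactly j - 1 chords
  -- come after it.  There is no such chord when j exceeds the number of
  -- chords.
  NthToLast : ℕ → Fin m → Set
  NthToLast j d = IsSource d × suc (length (filter (d <?_) sources)) ≡ j

  KTerminal : ℕ → Set
  KTerminal k = ∀ j → 1 ≤ j → j ≤ k →
    ∀ c d → IsSource c → NthToLast j d → c < d → ¬ TerminalChord j c

KTerminalDiagram : ℕ → ℕ → Set
KTerminalDiagram k n = ∃[ T ] KTerminal {2 * n} T k

KTerminalDiagrams : ℕ → ℕ → Setoid 0ℓ 0ℓ
KTerminalDiagrams k n = record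
  { Carrier       = KTerminalDiagram k n
  ; _≈_           = λ T U → proj₁ T ≈ proj₁ U
  ; isEquivalence = record
    { refl  = λ _ → refl
    ; sym   = λ T≈U p → sym (T≈U p)
    ; trans = λ T≈U U≈V p → trans (T≈U p) (U≈V p)
    }
  }

------------------------------------------------------------------------
-- Moving each source to the end of its source-sink group

if-↭ : ∀ {A : Set} b {xs ys zs : List A} → xs ↭ zs → ys ↭ zs →
       (if b then xs else ys) ↭ zs
if-↭ true  xs↭zs _     = xs↭zs
if-↭ false _     ys↭zs = ys↭zs

module _ {m : ℕ} (T : PerfectMatching m) where

  -- The arguments list the endpoints still to be read, from left to right.
  -- In carrySource s, the source s has been read, the sinks of its group
  -- are being passed over, and s is put down as soon as the group ends.  A
  -- group ends before the sink of its own chord; in a 1-terminal diagram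
  -- this can only happen for the last chord.
  mutual
    moveSources : List (Fin m) → List (Fin m)
    moveSources []       = []
    moveSources (p ∷ ps) =
      if does (isSource? T p) then carrySource p ps else p ∷ moveSources ps

    carrySource : Fin m → List (Fin m) → List (Fin m)
    carrySource s []       = s ∷ []
    carrySource s (p ∷ ps) =
      if does (isSink? T p ×-dec ¬? (p ≟ partner T s))
      then p ∷ carrySource s ps
      else s ∷ moveSources (p ∷ ps)

  mutual
    moveSources-↭ : ∀ ps → moveSources ps ↭ ps
    moveSources-↭ []       = ↭-refl
    moveSources-↭ (p ∷ ps) = if-↭ (does (isSource? T p))
      (carrySource-↭ p ps)
      (prep p (moveSources-↭ ps))

    carrySource-↭ : ∀ s ps → carrySource s ps ↭ s ∷ ps
    carrySource-↭ s []       = ↭-refl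
    carrySource-↭ s (p ∷ ps) = if-↭ (does (isSink? T p ×-dec ¬? (p ≟ partner T s)))
      (↭-trans (prep p (carrySource-↭ s ps)) (swap p s ↭-refl))
      (prep s (moveSources-↭ (p ∷ ps)))

------------------------------------------------------------------------
-- Deleting points

delete : ∀ {m} → Fin m → List (Fin m) → List (Fin m)
delete p = filter (λ q → ¬? (q ≟ p))

length-delete : ∀ {m} {p : Fin m} {ps} → Unique ps → p ∈ ps →
                suc (length (delete p ps)) ≡ length ps
length-delete {p = p} {q ∷ qs} (q≢qs ∷ qs!) p∈ with q ≟ p | p∈
... | yes refl | _         =
  cong (suc ∘ length) (filter-all _ (All.map (λ q≢r → q≢r ∘ sym) q≢qs))
... | no q≢p   | here p≡q  = contradiction (sym p≡q) q≢p
... | no _     | there p∈qs = cong suc (length-delete qs! p∈qs)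

------------------------------------------------------------------------
-- Order-preserving relabelling

lookup-injective : ∀ {A : Set} {xs : List A} → Unique xs →
                   ∀ i j → lookup xs i ≡ lookup xs j → i ≡ j
lookup-injective (_ ∷ _)     zero        zero        _  = refl
lookup-injective (x≢ ∷ _)    zero        (Fin.suc j) eq =
  contradiction eq (All.lookup x≢ (∈-lookup j))
lookup-injective (x≢ ∷ _)    (Fin.suc i) zero        eq =
  contradiction (sym eq) (All.lookup x≢ (∈-lookup i))
lookup-injective (_ ∷ xs!)   (Fin.suc i) (Fin.suc j) eq =
  cong Fin.suc (lookup-injective xs! i j eq)

-- The matching induced by T on the points in the list ps, where the new
-- name of a point is its position in ps.
relabel : ∀ {m m′} (T : PerfectMatching m) (ps : List (Fin m)) →
          length ps ≡ m′ → Unique ps →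
          (∀ {p} → p ∈ ps → partner T p ∈ ps) → PerfectMatching m′
relabel T ps refl ps! closed = record
  { partner            = π
  ; partner-involutive = λ i → lookup-injective ps! (π (π i)) i
      (trans (lookup-π (π i))
      (trans (cong (partner T) (lookup-π i)) (partner-involutive T (lookup ps i))))
  ; partner-irrefl     = λ i πi≡i → partner-irrefl T (lookup ps i)
      (trans (sym (lookup-π i)) (cong (lookup ps) πi≡i))
  }
  where
  π : Fin (length ps) → Fin (length ps)
  π i = index (closed (∈-lookup i))

  lookup-π : ∀ i → lookup ps (π i) ≡ partner T (lookup ps i)
  lookup-π i = sym (lookup-index (closed (∈-lookup i)))

------------------------------------------------------------------------
-- The map ψ

-- The default value is immaterial: point 0 is always a source.
lastSource : ∀ n → ChordDiagram (suc n) → Fin (2 * suc n)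
lastSource n T = fromMaybe zero (last (sources T))

module _ (n : ℕ) (T : ChordDiagram (suc n)) where

  private
    c c′ : Fin (2 * suc n)
    c  = lastSource n T
    c′ = partner T c

    moved : List (Fin (2 * suc n))
    moved = moveSources T (allFin (2 * suc n))

    moved-↭ : moved ↭ allFin (2 * suc n)
    moved-↭ = moveSources-↭ T (allFin (2 * suc n))

    moved! : Unique moved
    moved! = Unique-resp-↭ (setoid _) (↭⇒↭ₛ (↭-sym moved-↭)) (Unique.allFin⁺ _)

    ∈-moved : ∀ p → p ∈ moved
    ∈-moved p = ∈-resp-↭ (↭-sym moved-↭) (∈-allFin p)

  -- The endpoints left after both steps, in their new order.
  ψ-points : List (Fin (2 * suc n))
  ψ-points = delete c′ (delete c moved)

  ψ-points-unique : Unique ψ-points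
  ψ-points-unique = Unique.filter⁺ _ (Unique.filter⁺ _ moved!)

  ψ-points-length : length ψ-points ≡ 2 * n
  ψ-points-length = suc-injective (suc-injective
    (trans (cong suc (length-delete (Unique.filter⁺ _ moved!)
                        (∈-filter⁺ _ (∈-moved c′) (partner-irrefl T c))))
    (trans (length-delete moved! (∈-moved c))
    (trans (↭-length moved-↭)
    (trans (length-tabulate {n = 2 * suc n} id) (*-suc 2 n))))))

  ψ-points-closed : ∀ {p} → p ∈ ψ-points → partner T p ∈ ψ-points
  ψ-points-closed {p} p∈ =
    ∈-filter⁺ _ (∈-filter⁺ _ (∈-moved (partner T p)) p′≢c) p′≢c′
    where
    p≢c′ : p ≢ c′
    p≢c′ = proj₂ (∈-filter⁻ (λ q → ¬? (q ≟ c′)) {xs = delete c moved} p∈)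

    p≢c : p ≢ c
    p≢c = proj₂ (∈-filter⁻ (λ q → ¬? (q ≟ c)) {xs = moved}
            (proj₁ (∈-filter⁻ (λ q → ¬? (q ≟ c′)) {xs = delete c moved} p∈)))

    p′≢c : partner T p ≢ c
    p′≢c eq = p≢c′ (trans (sym (partner-involutive T p)) (cong (partner T) eq))

    p′≢c′ : partner T p ≢ c′
    p′≢c′ eq = p≢c (trans (sym (partner-involutive T p))
                   (trans (cong (partner T) eq) (partner-involutive T c)))

-- The same recipe makes sense for every nonempty diagram, so ψ is defined
-- without a terminality hypothesis; only its values on 1-terminal diagrams
-- are of interest.
ψ : ∀ n → ChordDiagram (suc n) → ChordDiagram n
ψ n T = relabel T (ψ-points n T)
  (ψ-points-length n T) (ψ-points-unique n T) (ψ-points-closed n T)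

{-# OPTIONS --safe #-}
module Submission where

-- Write a 1-terminal diagram as a₁ a₂ D₂ a₃ D₃ … aₙ Dₙ bₙ with sources aᵢ and
-- runs of sinks Dᵢ: 1-terminality forces bₙ to the end and keeps the sink of
-- aᵢ out of Dᵢ.  Its image under ψ is a₁ D₂ a₂ D₃ … aₙ₋₁ Dₙ, so that the
-- pattern of sources and sinks only loses its first and its last entry, and
-- every sink in Dᵢ stays matched to the same chord, counted in the order of
-- sources.  This description can be inverted for every diagram.  The right
-- neighbor that a chord with sink in Dᵢ loses is exactly aᵢ, so every chord
-- but the last loses exactly one, which lowers the level of terminality by one.

open import Defs
open import Data.Fin.Base as Fin using (Fin; zero; suc; toℕ; fromℕ; inject₁; cast; _<_)
open import Data.Fin.Induction using (<-weakInduction; >-weakInduction)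
open import Data.Fin.Properties
  using (_≟_; _<?_; <-cmp; toℕ-injective; toℕ-inject₁; ≤fromℕ; ≤∧≢⇒<;
         inject₁-injective; fromℕ≢inject₁; cast-is-id; suc-injective)
open import Data.Fin.Relation.Unary.Top using (view; ‵fromℕ; ‵inject₁)
open import Data.List.Base using (List; []; _∷_; allFin; filter; last; length; lookup; map; tabulate)
open import Data.List.Membership.Propositional using (_∈_)
open import Data.List.Membership.Propositional.Properties
  using (∈-allFin; ∈-filter⁺; ∈-filter⁻; ∈-lookup; ∈-map⁺; ∈-map⁻)
open import Data.List.Membership.Propositional.Properties.WithK using (unique∧set⇒bag)
open import Data.List.Properties using (filter-accept; filter-reject; filter-none; length-map)
open import Data.List.Relation.Binary.BagAndSetEquality using (∼bag⇒↭)
open import Data.List.Relation.Binary.Permutation.Propositional.Properties using (↭-length)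
open import Data.List.Relation.Binary.Pointwise.Base using (Pointwise; []; _∷_)
import Data.List.Relation.Unary.All as All
open import Data.List.Relation.Unary.AllPairs using (AllPairs; []; _∷_)
import Data.List.Relation.Unary.AllPairs.Properties as AllPairs
open import Data.List.Relation.Unary.Any using (here; there; index)
open import Data.List.Relation.Unary.Any.Properties using (lookup-index)
open import Data.List.Relation.Unary.Unique.Propositional using (Unique)
import Data.List.Relation.Unary.Unique.Propositional.Properties as Unique
open import Data.Maybe.Base using (fromMaybe)
open import Data.Nat.Base as ℕ using (ℕ; suc; _≤_; _∸_; _*_; s≤s; z≤n)
open import Data.Nat.Properties as ℕ using (*-suc)
open import Data.Product.Base using (Σ-syntax; ∃-syntax; _×_; _,_; proj₁; proj₂)
open import Data.Sum.Base using (_⊎_; inj₁; inj₂)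
open import Function.Base using (_∘_; id)
open import Function.Bundles using (Bijection; mk⇔)
open import Relation.Binary.Definitions using (tri<; tri≈; tri>)
open import Relation.Binary.PropositionalEquality
  using (_≡_; _≢_; refl; sym; trans; cong; subst; subst₂)
open import Relation.Nullary.Decidable using (yes; no; dec-true; dec-false; _×-dec_; ¬?)
open import Relation.Nullary.Negation using (¬_; contradiction)
open import Relation.Unary using (Decidable)

-- Sources and sinks of a matching

module _ {m : ℕ} (T : PerfectMatching m) where

  partner-injective : ∀ {p q} → partner T p ≡ partner T q → p ≡ q
  partner-injective {p} {q} eq =
    trans (sym (partner-involutive T p)) (trans (cong (partner T) eq) (partner-involutive T q))

  source-or-sink : ∀ p → IsSource T p ⊎ IsSink T p
  source-or-sink p with <-cmp p (partner T p)
  ... | tri< p<p′ _ _ = inj₁ p<p′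
  ... | tri≈ _ p≡p′ _ = contradiction (sym p≡p′) (partner-irrefl T p)
  ... | tri> _ _ p′<p = inj₂ p′<p

  source-not-sink : ∀ {p} → IsSource T p → ¬ IsSink T p
  source-not-sink = ℕ.<-asym

  not-source⇒sink : ∀ {p} → ¬ IsSource T p → IsSink T p
  not-source⇒sink {p} ¬src with source-or-sink p
  ... | inj₁ src = contradiction src ¬src
  ... | inj₂ snk = snk

  partner-of-source : ∀ {p} → IsSource T p → IsSink T (partner T p)
  partner-of-source {p} = subst (_< partner T p) (sym (partner-involutive T p))

  partner-of-sink : ∀ {p} → IsSink T p → IsSource T (partner T p)
  partner-of-sink {p} = subst (partner T p <_) (sym (partner-involutive T p))

  ∈-sources⁺ : ∀ {p} → IsSource T p → p ∈ sources T
  ∈-sources⁺ {p} = ∈-filter⁺ (isSource? T) (∈-allFin p)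

  ∈-sources⁻ : ∀ {p} → p ∈ sources T → IsSource T p
  ∈-sources⁻ p∈ = proj₂ (∈-filter⁻ (isSource? T) {xs = allFin m} p∈)

  sources-unique : Unique (sources T)
  sources-unique = Unique.filter⁺ (isSource? T) (Unique.allFin⁺ m)

  sources-increasing : AllPairs _<_ (sources T)
  sources-increasing = AllPairs.filter⁺ (isSource? T) (AllPairs.tabulate⁺-< id)

  none-after-last : (c : Fin m) → (∀ x → IsSource T x → x Fin.≤ c) →
                    length (filter (c <?_) (sources T)) ≡ 0
  none-after-last c ≤c = cong length (filter-none (c <?_)
    (All.tabulate λ y∈ c<y → ℕ.<⇒≱ c<y (≤c _ (∈-sources⁻ y∈))))

source-resp-≈ : ∀ {m} {T U : PerfectMatching m} {p} → T ≈ U → IsSource T p → IsSource U p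
source-resp-≈ {p = p} T≈U = subst (p <_) (T≈U p)

-- The partner of a source is a sink, so involutivity recovers the values at sources from those at
-- sinks.
≈-from-sinks : ∀ {m} {T U : PerfectMatching m} →
               (∀ p → IsSink T p → partner T p ≡ partner U p) → T ≈ U
≈-from-sinks {T = T} {U} agree p with source-or-sink T p
... | inj₂ snk = agree p snk
... | inj₁ src = trans
  (sym (partner-involutive U (partner T p)))
  (cong (partner U) (trans (sym (agree _ (partner-of-source T src))) (partner-involutive T p)))

-- Consecutive sources

-- No condition is put on `t`, so that the relation also applies to sinks, to the end point and to
-- the position reached in a scan.
Predecessor : ∀ {m} → (Fin m → Set) → Fin m → Fin m → Set
Predecessor P s t = P s × s < t × (∀ x → P x → x < t → x Fin.≤ s)

module _ {m : ℕ} where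

  predecessor-resp : {P Q : Fin m → Set} {s t : Fin m} →
                     (∀ {x} → P x → Q x) → (∀ {x} → Q x → P x) →
                     Predecessor P s t → Predecessor Q s t
  predecessor-resp P⇒Q Q⇒P (Ps , s<t , max) = P⇒Q Ps , s<t , λ x Qx → max x (Q⇒P Qx)

  predecessor-unique : {P : Fin m → Set} {s s′ t : Fin m} →
                       Predecessor P s t → Predecessor P s′ t → s ≡ s′
  predecessor-unique (Ps , s<t , max) (Ps′ , s′<t , max′) =
    toℕ-injective (ℕ.≤-antisym (max′ _ Ps s<t) (max _ Ps′ s′<t))

  successor-unique : {P : Fin m → Set} {s t t′ : Fin m} → P t → P t′ →
                     Predecessor P s t → Predecessor P s t′ → t ≡ t′
  successor-unique {t = t} {t′} Pt Pt′ (_ , s<t , max) (_ , s<t′ , max′) with <-cmp t t′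
  ... | tri< t<t′ _ _ = contradiction (max′ _ Pt t<t′) (ℕ.<⇒≱ s<t)
  ... | tri≈ _ t≡t′ _ = t≡t′
  ... | tri> _ _ t′<t = contradiction (max _ Pt′ t′<t) (ℕ.<⇒≱ s<t′)

<suc⇒≤inject₁ : ∀ {n} {x : Fin (suc n)} {i : Fin n} → x < suc i → x Fin.≤ inject₁ i
<suc⇒≤inject₁ {x = x} {i} (s≤s x≤i) = subst (toℕ x ≤_) (sym (toℕ-inject₁ i)) x≤i

inject₁<suc : ∀ {n} (i : Fin n) → inject₁ i < suc i
inject₁<suc i = s≤s (ℕ.≤-reflexive (toℕ-inject₁ i))

≤-split : ∀ {n} {x y : Fin n} → x Fin.≤ y → x < y ⊎ x ≡ y
≤-split {x = x} {y} x≤y with x ≟ y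
... | yes x≡y = inj₂ x≡y
... | no  x≢y = inj₁ (≤∧≢⇒< x≤y x≢y)

module _ {n : ℕ} {P : Fin (suc n) → Set} (P? : Decidable P) where

  -- Upward induction: the step to `suc i` admits one new candidate, `inject₁ i`, which wins if it
  -- satisfies `P`; otherwise the previous answer stays, and `P zero` guarantees that there is one.
  predecessor-exists : P zero → ∀ t → zero {n} < t → ∃[ s ] Predecessor P s t
  predecessor-exists P0 = <-weakInduction _ (λ ()) step
    where
    step : ∀ i → (zero {n} < inject₁ i → ∃[ s ] Predecessor P s (inject₁ i)) →
           zero {n} < suc i → ∃[ s ] Predecessor P s (suc i)
    step i rec _ with P? (inject₁ i)
    ... | yes Pi = inject₁ i , Pi , inject₁<suc i , λ _ _ → <suc⇒≤inject₁
    ... | no ¬Pi with ≤-split {x = zero} {inject₁ i} z≤n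
    ...   | inj₂ 0≡i = contradiction (subst P 0≡i P0) ¬Pi
    ...   | inj₁ 0<i with rec 0<i
    ...     | s , Ps , s<i , max = s , Ps , ℕ.<-trans s<i (inject₁<suc i) , max′
      where
      max′ : ∀ x → P x → x < suc i → x Fin.≤ s
      max′ x Px x<i with ≤-split (<suc⇒≤inject₁ x<i)
      ... | inj₁ x<i = max x Px x<i
      ... | inj₂ refl = contradiction Px ¬Pi

  -- The end point counts as a successor even when it does not satisfy P.
  successor-exists : ∀ s → P s → s ≢ fromℕ n →
                     ∃[ t ] Predecessor P s t × (P t ⊎ t ≡ fromℕ n)
  successor-exists s Ps s≢end = next (least s)
    where
    -- The least element above s, found downwards from the end.
    LeastAbove : Fin (suc n) → Set
    LeastAbove s = s ≢ fromℕ n → ∃[ t ] (s < t × (∀ x → P x → x < t → x Fin.≤ s) × (P t ⊎ t ≡ fromℕ n))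

    step : ∀ i → LeastAbove (suc i) → LeastAbove (inject₁ i)
    step i rec _ with P? (suc i) | suc i ≟ fromℕ n
    ... | yes Pi | _ = suc i , inject₁<suc i , (λ _ _ → <suc⇒≤inject₁) , inj₁ Pi
    ... | no ¬Pi | yes i≡end = suc i , inject₁<suc i , (λ _ _ → <suc⇒≤inject₁) , inj₂ i≡end
    ... | no ¬Pi | no i≢end with rec i≢end
    ...   | t , i<t , max , Pt = t , ℕ.<-trans (inject₁<suc i) i<t , max′ , Pt
      where
      max′ : ∀ x → P x → x < t → x Fin.≤ inject₁ i
      max′ x Px x<t with ≤-split (max x Px x<t)
      ... | inj₁ x<i  = <suc⇒≤inject₁ x<i
      ... | inj₂ refl = contradiction Px ¬Pi

    least : ∀ s → LeastAbove s
    least = >-weakInduction _ (λ end≢end → contradiction refl end≢end) step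

    next : LeastAbove s → _
    next above with above s≢end
    ... | t , s<t , max , Pt = t , (Ps , s<t , max) , Pt

-- The points of a matching of size m + 2

-- Position `q` of the smaller diagram corresponds to position `ι q` of the larger one, whose first
-- source and last sink have no counterpart.
ι : ∀ {m} → Fin m → Fin (suc (suc m))
ι q = suc (inject₁ q)

end : ∀ {m} → Fin (suc m)
end {m} = fromℕ m

data Position {m : ℕ} : Fin (suc (suc m)) → Set where
  first : Position zero
  inner : ∀ q → Position (ι q)
  final : Position end

position : ∀ {m} (p : Fin (suc (suc m))) → Position p
position zero = first
position (suc p) with view p
... | ‵fromℕ     = final
... | ‵inject₁ q = inner q

module _ {m : ℕ} where

  ι-injective : {q r : Fin m} → ι q ≡ ι r → q ≡ r
  ι-injective eq = inject₁-injective (suc-injective eq)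

  ι≢end : {q : Fin m} → ι q ≢ end
  ι≢end eq = fromℕ≢inject₁ (sym (suc-injective eq))

  ι-mono-< : {q r : Fin m} → q < r → ι q < ι r
  ι-mono-< {q} {r} q<r = s≤s (subst₂ ℕ._<_ (sym (toℕ-inject₁ q)) (sym (toℕ-inject₁ r)) q<r)

  ι-cancel-< : {q r : Fin m} → ι q < ι r → q < r
  ι-cancel-< {q} {r} (s≤s q<r) = subst₂ ℕ._<_ (toℕ-inject₁ q) (toℕ-inject₁ r) q<r

  ι<end : {q : Fin m} → ι q < end {suc m}
  ι<end {q} = ≤∧≢⇒< (≤fromℕ (ι q)) ι≢end

¬end< : ∀ {m} {p : Fin (suc m)} → ¬ end < p
¬end< {p = p} end<p = ℕ.<⇒≱ end<p (≤fromℕ p)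

zero-source : ∀ {m} (T : PerfectMatching (suc m)) → IsSource T zero
zero-source T with source-or-sink T zero
... | inj₁ src = src
... | inj₂ ()

end-sink : ∀ {m} (T : PerfectMatching (suc m)) → IsSink T end
end-sink T = not-source⇒sink T ¬end<

-- The shift relation

-- Chords correspond in the order of their sources, the last chord of T being
-- unmatched; sinks move by one position, and a source of U sits one position
-- before the next source of T.
record Shift {m : ℕ} (T : PerfectMatching (suc (suc m))) (U : PerfectMatching m) : Set where
  field
    source⁺   : ∀ {q} → IsSource U q → IsSource T (ι q)
    source⁻   : ∀ {q} → IsSource T (ι q) → IsSource U q
    innerSink : ∀ {q} → IsSink U q → Predecessor (IsSource T) (partner T (ι q)) (ι (partner U q))
    finalSink : Predecessor (IsSource T) (partner T end) end

open Shift

-- In `innerSink` the left end `partner T (ι q)` is fixed by `T`, and the right end is forced to be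
-- the next source after it.
Shift-functional : ∀ {m} {T T′ : PerfectMatching (suc (suc m))} {U U′} →
                   Shift T U → Shift T′ U′ → T ≈ T′ → U ≈ U′
Shift-functional {T = T} {T′} {U} {U′} S S′ T≈T′ = ≈-from-sinks {T = U} {U′} agree
  where
  agree : ∀ q → IsSink U q → partner U q ≡ partner U′ q
  agree q snk = ι-injective (successor-unique
    (source⁺ S (partner-of-sink U snk))
    (source-resp-≈ {T = T′} {T} T′≈T (source⁺ S′ (partner-of-sink U′ snk′)))
    (innerSink S snk)
    (subst (λ s → Predecessor (IsSource T) s (ι (partner U′ q))) (sym (T≈T′ (ι q)))
      (predecessor-resp (source-resp-≈ {T = T′} {T} T′≈T) (source-resp-≈ {T = T} {T′} T≈T′)
        (innerSink S′ snk′))))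
    where
    T′≈T : T′ ≈ T
    T′≈T p = sym (T≈T′ p)

    snk′ : IsSink U′ q
    snk′ = not-source⇒sink U′ λ src → source-not-sink U
      (source⁻ S (source-resp-≈ {T = T′} {T} T′≈T (source⁺ S′ src))) snk

-- The first point is always a source and the end never is; `source⁺` and `source⁻` settle the
-- points in between.
Shift-source : ∀ {m} {T T′ : PerfectMatching (suc (suc m))} {U U′} →
               Shift T U → Shift T′ U′ → U ≈ U′ → ∀ {p} → IsSource T p → IsSource T′ p
Shift-source {T′ = T′} {U} {U′} S S′ U≈U′ {p} src with position p
... | first   = zero-source T′
... | inner q = source⁺ S′ (source-resp-≈ {T = U} {U′} U≈U′ (source⁻ S src))
... | final   = contradiction src ¬end<

-- Here `U` fixes the right end in `innerSink`, and the left end is the unique source preceding it;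
-- `finalSink` does the same for the end point.
Shift-injective : ∀ {m} {T T′ : PerfectMatching (suc (suc m))} {U U′} →
                  Shift T U → Shift T′ U′ → U ≈ U′ → T ≈ T′
Shift-injective {T = T} {T′} {U} {U′} S S′ U≈U′ = ≈-from-sinks {T = T} {T′} agree
  where
  resp : ∀ {s t} → Predecessor (IsSource T) s t → Predecessor (IsSource T′) s t
  resp = predecessor-resp (Shift-source S S′ U≈U′) (Shift-source S′ S (λ q → sym (U≈U′ q)))

  agree : ∀ p → IsSink T p → partner T p ≡ partner T′ p
  agree p snk with position p
  ... | first   = contradiction snk (source-not-sink T (zero-source T))
  ... | final   = predecessor-unique (resp (finalSink S)) (finalSink S′)
  ... | inner q = predecessor-unique (resp (innerSink S snkU))
      (subst (λ s → Predecessor (IsSource T′) (partner T′ (ι q)) (ι s)) (sym (U≈U′ q))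
        (innerSink S′ (subst (_< q) (U≈U′ q) snkU)))
    where
    snkU : IsSink U q
    snkU = not-source⇒sink U λ src → source-not-sink T (source⁺ S src) snk

-- Every matching is a shift

module _ {m : ℕ} (U : PerfectMatching m) where

  private
    -- The sources that the preimage is meant to have, prescribed before its matching exists;
    -- `Src⇒source` and `source⇒Src` confirm them afterwards.
    Src : Fin (suc (suc m)) → Set
    Src p = p ≡ zero ⊎ ∃[ q ] (IsSource U q × p ≡ ι q)

    Src? : Decidable Src
    Src? p with position p
    ... | first = yes (inj₁ refl)
    ... | final = no λ { (inj₂ (q , _ , eq)) → ι≢end (sym eq) }
    ... | inner q with isSource? U q
    ...   | yes src = yes (inj₂ (q , src , refl))
    ...   | no ¬src = no λ { (inj₂ (r , src , eq)) → ¬src (subst (IsSource U) (sym (ι-injective eq)) src) }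

    ¬Src-end : ¬ Src end
    ¬Src-end (inj₂ (_ , _ , eq)) = ι≢end (sym eq)

    Src-ι⁻ : ∀ {q} → Src (ι q) → IsSource U q
    Src-ι⁻ (inj₂ (_ , src , eq)) = subst (IsSource U) (sym (ι-injective eq)) src

    -- The chord of T with sink b is the one whose source precedes t.
    data Anchor (t b : Fin (suc (suc m))) : Set where
      inner : ∀ {q} → IsSource U q → t ≡ ι q → b ≡ ι (partner U q) → Anchor t b
      final : t ≡ end → b ≡ end → Anchor t b

    Chord : Fin (suc (suc m)) → Fin (suc (suc m)) → Set
    Chord s b = ∃[ t ] (Predecessor Src s t × Anchor t b)

    anchor-≤ : ∀ {t b} → Anchor t b → t Fin.≤ b
    anchor-≤ (inner src refl refl) = ℕ.<⇒≤ (ι-mono-< src)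
    anchor-≤ (final refl refl)     = ℕ.≤-refl

    anchor-sink : ∀ {t b} → Anchor t b → ¬ Src b
    anchor-sink (inner src _ refl) srcb = source-not-sink U (Src-ι⁻ srcb) (partner-of-source U src)
    anchor-sink (final _ refl)          = ¬Src-end

    anchor-uniqueˡ : ∀ {t t′ b} → Anchor t b → Anchor t′ b → t ≡ t′
    anchor-uniqueˡ (inner _ refl refl) (inner _ refl eq) =
      cong ι (partner-injective U (ι-injective eq))
    anchor-uniqueˡ (inner _ _ refl) (final _ eq) = contradiction eq ι≢end
    anchor-uniqueˡ (final _ refl) (inner _ _ eq) = contradiction (sym eq) ι≢end
    anchor-uniqueˡ (final refl _) (final refl _) = refl

    anchor-uniqueʳ : ∀ {t b b′} → Anchor t b → Anchor t b′ → b ≡ b′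
    anchor-uniqueʳ (inner _ refl refl) (inner _ eq refl) = cong (ι ∘ partner U) (ι-injective eq)
    anchor-uniqueʳ (inner _ refl _) (final eq _) = contradiction eq ι≢end
    anchor-uniqueʳ (final refl _) (inner _ eq _) = contradiction (sym eq) ι≢end
    anchor-uniqueʳ (final _ refl) (final _ refl) = refl

    chord-< : ∀ {s b} → Chord s b → s < b
    chord-< (_ , (_ , s<t , _) , anc) = ℕ.<-≤-trans s<t (anchor-≤ anc)

    chord-source-unique : ∀ {s s′ b} → Chord s b → Chord s′ b → s ≡ s′
    chord-source-unique (_ , pred , anc) (_ , pred′ , anc′)
      with refl ← anchor-uniqueˡ anc anc′ = predecessor-unique pred pred′

    anchor-marks : ∀ {t b} → Anchor t b → Src t ⊎ t ≡ end
    anchor-marks (inner src eq _) = inj₁ (inj₂ (_ , src , eq))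
    anchor-marks (final eq _)     = inj₂ eq

    -- The anchor belonging to `s` is the next source, or the end if there is none. Were one anchor
    -- a source below the end and the other the end itself, that source would lie above `s` and yet
    -- be at most `s`.
    chord-sink-unique : ∀ {s b b′} → Chord s b → Chord s b′ → b ≡ b′
    chord-sink-unique (t , pred , anc) (t′ , pred′ , anc′)
      with anchor-marks anc | anchor-marks anc′
    ... | inj₁ Pt   | inj₁ Pt′  with refl ← successor-unique Pt Pt′ pred pred′ = anchor-uniqueʳ anc anc′
    ... | inj₂ refl | inj₂ refl = anchor-uniqueʳ anc anc′
    ... | inj₁ Pt   | inj₂ refl with ≤-split (≤fromℕ t)
    ...   | inj₁ t<end = contradiction (proj₂ (proj₂ pred′) t Pt t<end) (ℕ.<⇒≱ (proj₁ (proj₂ pred)))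
    ...   | inj₂ refl  = anchor-uniqueʳ anc anc′
    chord-sink-unique (t , pred , anc) (t′ , pred′ , anc′)
        | inj₂ refl | inj₁ Pt′ with ≤-split (≤fromℕ t′)
    ...   | inj₁ t′<end = contradiction (proj₂ (proj₂ pred) t′ Pt′ t′<end) (ℕ.<⇒≱ (proj₁ (proj₂ pred′)))
    ...   | inj₂ refl   = anchor-uniqueʳ anc anc′

    sink-exists : ∀ {s} → Src s → ∃[ b ] Chord s b
    sink-exists {s} Ps with successor-exists Src? s Ps (λ { refl → ¬Src-end Ps })
    ... | t , pred , inj₂ t≡end = end , t , pred , final t≡end refl
    ... | t , pred , inj₁ (inj₂ (q , src , t≡)) = ι (partner U q) , t , pred , inner src t≡ refl
    ... | t , (_ , () , _) , inj₁ (inj₁ refl)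

    source-exists : ∀ {b} → ¬ Src b → ∃[ s ] Chord s b
    source-exists {b} ¬Pb with position b
    ... | first = contradiction (inj₁ refl) ¬Pb
    ... | final with s , pred ← predecessor-exists Src? (inj₁ refl) end (s≤s z≤n) =
      s , end , pred , final refl refl
    ... | inner r with s , pred ← predecessor-exists Src? (inj₁ refl) (ι (partner U r)) (s≤s z≤n) =
      s , _ , pred , inner (partner-of-sink U snk) refl (cong ι (sym (partner-involutive U r)))
      where
      snk : IsSink U r
      snk = not-source⇒sink U λ src → ¬Pb (inj₂ (r , src , refl))

    data Matched (p : Fin (suc (suc m))) : Set where
      asSource : ∀ b → Chord p b → Matched p
      asSink   : ∀ s → Chord s p → Matched p

    matched : ∀ p → Matched p
    matched p with Src? p
    ... | yes Pp with b , ch ← sink-exists Pp   = asSource b ch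
    ... | no ¬Pp with s , ch ← source-exists ¬Pp = asSink s ch

    other : ∀ {p} → Matched p → Fin (suc (suc m))
    other (asSource b _) = b
    other (asSink s _)   = s

    chord-source : ∀ {s b} → Chord s b → Src s
    chord-source (_ , (Ps , _) , _) = Ps

    chord-sink : ∀ {s b} → Chord s b → ¬ Src b
    chord-sink (_ , _ , anc) = anchor-sink anc

    -- Stated for arbitrary witnesses, so that the case analysis need not unfold `matched`. Opposite
    -- orientations use uniqueness of chords; equal ones would make a point both source and sink.
    other-involutive : ∀ {p} (x : Matched p) (y : Matched (other x)) → other y ≡ p
    other-involutive (asSource _ ch) (asSource _ ch′) = contradiction (chord-source ch′) (chord-sink ch)
    other-involutive (asSource _ ch) (asSink _ ch′)   = chord-source-unique ch′ ch
    other-involutive (asSink _ ch)   (asSource _ ch′) = chord-sink-unique ch′ ch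
    other-involutive (asSink _ ch)   (asSink _ ch′)   = contradiction (chord-source ch) (chord-sink ch′)

    other-irrefl : ∀ {p} (x : Matched p) → other x ≢ p
    other-irrefl (asSource _ ch) refl = ℕ.<-irrefl refl (chord-< ch)
    other-irrefl (asSink _ ch)   refl = ℕ.<-irrefl refl (chord-< ch)

  unshift : PerfectMatching (suc (suc m))
  unshift = record
    { partner            = λ p → other (matched p)
    ; partner-involutive = λ p → other-involutive (matched p) (matched _)
    ; partner-irrefl     = λ p → other-irrefl (matched p)
    }

  private
    Src⇒source : ∀ {p} → Src p → IsSource unshift p
    Src⇒source {p} Pp with matched p
    ... | asSource _ ch = chord-< ch
    ... | asSink _ ch   = contradiction Pp (chord-sink ch)

    source⇒Src : ∀ {p} → IsSource unshift p → Src p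
    source⇒Src {p} src with matched p
    ... | asSource _ ch = chord-source ch
    ... | asSink _ ch   = contradiction (chord-< ch) (ℕ.<-asym src)

    chord-to-sink : ∀ {p} → ¬ Src p → Chord (partner unshift p) p
    chord-to-sink {p} ¬Pp with matched p
    ... | asSource _ ch = contradiction (chord-source ch) ¬Pp
    ... | asSink _ ch   = ch

  unshift-Shift : Shift unshift U
  unshift-Shift = record
    { source⁺   = λ src → Src⇒source (inj₂ (_ , src , refl))
    ; source⁻   = λ src → Src-ι⁻ (source⇒Src src)
    ; innerSink = λ snk → inner-pred snk (chord-to-sink λ Pq → source-not-sink U (Src-ι⁻ Pq) snk)
    ; finalSink = final-pred (chord-to-sink ¬Src-end)
    }
    where
    inner-pred : ∀ {s q} → IsSink U q → Chord s (ι q) →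
                 Predecessor (IsSource unshift) s (ι (partner U q))
    inner-pred snk (_ , pred , final _ eq) = contradiction eq ι≢end
    inner-pred {s} {q} snk (_ , pred , inner {q′} _ refl eq) =
      subst (λ r → Predecessor (IsSource unshift) s (ι r))
        (sym (trans (cong (partner U) (ι-injective eq)) (partner-involutive U q′)))
        (predecessor-resp Src⇒source source⇒Src pred)

    final-pred : ∀ {s} → Chord s end → Predecessor (IsSource unshift) s end
    final-pred (_ , pred , final refl _) = predecessor-resp Src⇒source source⇒Src pred
    final-pred (_ , pred , inner _ _ eq) = contradiction (sym eq) ι≢end

-- Counting chords

length-≡ : ∀ {A : Set} {xs ys : List A} → Unique xs → Unique ys →
           (∀ {z} → z ∈ xs → z ∈ ys) → (∀ {z} → z ∈ ys → z ∈ xs) → length xs ≡ length ys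
length-≡ xs! ys! to from = ↭-length (∼bag⇒↭ (unique∧set⇒bag xs! ys! (mk⇔ to from)))

module _ {m : ℕ} {T : PerfectMatching (suc (suc m))} {U : PerfectMatching m} (S : Shift T U) where

  private
    -- For a source `q` of `U`, the source of the corresponding chord of `T`, found through the sink
    -- that both chords share up to `ι`.
    lift : Fin m → Fin (suc (suc m))
    lift q = partner T (ι (partner U q))

    -- The source of the last chord of `T`, the one without counterpart in `U`.
    c : Fin (suc (suc m))
    c = partner T end

    lift-injective : ∀ {q r} → lift q ≡ lift r → q ≡ r
    lift-injective eq = partner-injective U (ι-injective (partner-injective T eq))

    lift-predecessor : ∀ {q} → IsSource U q → Predecessor (IsSource T) (lift q) (ι q)
    lift-predecessor {q} src =
      subst (λ r → Predecessor (IsSource T) (lift q) (ι r)) (partner-involutive U q)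
        (innerSink S (partner-of-source U src))

    lift-source : ∀ {q} → IsSource U q → IsSource T (lift q)
    lift-source = proj₁ ∘ lift-predecessor

    lift<ι : ∀ {q} → IsSource U q → lift q < ι q
    lift<ι = proj₁ ∘ proj₂ ∘ lift-predecessor

    ≤lift : ∀ {q} → IsSource U q → ∀ x → IsSource T x → x < ι q → x Fin.≤ lift q
    ≤lift = proj₂ ∘ proj₂ ∘ lift-predecessor

    partner-lift : ∀ q → partner T (lift q) ≡ ι (partner U q)
    partner-lift q = partner-involutive T _

    lift-mono-< : ∀ {q r} → IsSource U q → IsSource U r → q < r → lift q < lift r
    lift-mono-< srcq srcr q<r =
      ℕ.<-≤-trans (lift<ι srcq) (≤lift srcr _ (source⁺ S srcq) (ι-mono-< q<r))

    lift-cancel-< : ∀ {q r} → IsSource U q → IsSource U r → lift q < lift r → q < r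
    lift-cancel-< {q} {r} srcq srcr lq<lr with <-cmp q r
    ... | tri< q<r _ _  = q<r
    ... | tri≈ _ refl _ = contradiction lq<lr (ℕ.<-irrefl refl)
    ... | tri> _ _ r<q  = contradiction lq<lr (ℕ.<-asym (lift-mono-< srcr srcq r<q))

    c-source : IsSource T c
    c-source = proj₁ (finalSink S)

    ≤c : ∀ {x} → IsSource T x → x Fin.≤ c
    ≤c {x} src = proj₂ (proj₂ (finalSink S)) x src
      (≤∧≢⇒< (≤fromℕ x) λ { refl → ¬end< src })

    lift≢c : ∀ {q} → lift q ≢ c
    lift≢c eq = ι≢end (partner-injective T eq)

    lift<c : ∀ {q} → IsSource U q → lift q < c
    lift<c srcq = ≤∧≢⇒< (≤c (lift-source srcq)) lift≢c

    -- The sink of `x` decides: the end point belongs to `c`, and an inner sink `ι r` belongs to the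
    -- lift of the chord of `U` with sink `r`.
    lift-surjective : ∀ {x} → IsSource T x → x ≢ c → ∃[ q ] (IsSource U q × x ≡ lift q)
    lift-surjective {x} src x≢c = go (position (partner T x)) refl
      where
      x≡ : ∀ {p} → partner T x ≡ p → x ≡ partner T p
      x≡ eq = trans (sym (partner-involutive T x)) (cong (partner T) eq)

      go : ∀ {p} → Position p → partner T x ≡ p → ∃[ q ] (IsSource U q × x ≡ lift q)
      go first eq = contradiction (subst (x <_) eq src) λ ()
      go final eq = contradiction (x≡ eq) x≢c
      go (inner r) eq = partner U r , partner-of-sink U snk ,
        trans (x≡ eq) (cong (partner T ∘ ι) (sym (partner-involutive U r)))
        where
        snk : IsSink U r
        snk = not-source⇒sink U λ srcr → source-not-sink T
          (source⁺ S srcr) (subst (IsSink T) eq (partner-of-source T src))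

    -- The counting scheme for later sources and for right neighbors: the chosen sources of `T` are
    -- the extra one `x` and the injective image under `lift` of the chosen sources of `U`.
    one-more : {P : Fin (suc (suc m)) → Set} {Q : Fin m → Set}
               (P? : Decidable P) (Q? : Decidable Q) (x : Fin (suc (suc m))) →
               IsSource T x → P x →
               (∀ {q} → IsSource U q → Q q → lift q ≢ x) →
               (∀ {q} → IsSource U q → Q q → P (lift q)) →
               (∀ {y} → IsSource T y → P y → y ≡ x ⊎ ∃[ q ] (IsSource U q × Q q × y ≡ lift q)) →
               length (filter P? (sources T)) ≡ suc (length (filter Q? (sources U)))
    one-more P? Q? x srcx Px fresh lifts covers = trans
      (length-≡ (Unique.filter⁺ P? (sources-unique T))
        (All.tabulate x∉ ∷ Unique.map⁺ lift-injective (Unique.filter⁺ Q? (sources-unique U)))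
        to from)
      (cong suc (length-map lift (filter Q? (sources U))))
      where
      decompose : ∀ {y} → y ∈ map lift (filter Q? (sources U)) →
                  ∃[ q ] (IsSource U q × _ × y ≡ lift q)
      decompose y∈ with q , q∈ , y≡ ← ∈-map⁻ lift y∈ with q∈U , Qq ← ∈-filter⁻ Q? {xs = sources U} q∈ =
        q , ∈-sources⁻ U q∈U , Qq , y≡

      x∉ : ∀ {y} → y ∈ map lift (filter Q? (sources U)) → x ≢ y
      x∉ y∈ refl with q , srcq , Qq , x≡ ← decompose y∈ = fresh srcq Qq (sym x≡)

      to : ∀ {y} → y ∈ filter P? (sources T) → y ∈ x ∷ map lift (filter Q? (sources U))
      to y∈ with y∈T , Py ← ∈-filter⁻ P? {xs = sources T} y∈ with covers (∈-sources⁻ T y∈T) Py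
      ... | inj₁ refl = here refl
      ... | inj₂ (q , srcq , Qq , refl) = there (∈-map⁺ lift (∈-filter⁺ Q? (∈-sources⁺ U srcq) Qq))

      from : ∀ {y} → y ∈ x ∷ map lift (filter Q? (sources U)) → y ∈ filter P? (sources T)
      from (here refl) = ∈-filter⁺ P? (∈-sources⁺ T srcx) Px
      from (there y∈) with q , srcq , Qq , refl ← decompose y∈ =
        ∈-filter⁺ P? (∈-sources⁺ T (lift-source srcq)) (lifts srcq Qq)

    -- The extra later source is `c`, which is no lift.
    later-sources : ∀ {q} → IsSource U q →
      length (filter (lift q <?_) (sources T)) ≡ suc (length (filter (q <?_) (sources U)))
    later-sources {q} srcq = one-more (lift q <?_) (q <?_) c c-source (lift<c srcq)
      (λ _ _ → lift≢c) (lift-mono-< srcq) covers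
      where
      covers : ∀ {y} → IsSource T y → lift q < y →
               y ≡ c ⊎ ∃[ r ] (IsSource U r × q < r × y ≡ lift r)
      covers {y} srcy q<y with y ≟ c
      ... | yes y≡c = inj₁ y≡c
      ... | no  y≢c with r , srcr , refl ← lift-surjective srcy y≢c =
        inj₂ (r , srcr , lift-cancel-< srcq srcr q<y , refl)

    -- The additional right neighbor is the last source before the sink.
    right-neighbors : ∀ {q} → IsSource U q →
      length (rightNeighbors T (lift q)) ≡ suc (length (rightNeighbors U q))
    right-neighbors {q} srcq with predecessor-exists (isSource? T) (zero-source T) (ι (partner U q)) (s≤s z≤n)
    ... | x , pred@(srcx , x<b , max) =
      one-more (isRightNeighbor? T (lift q)) (isRightNeighbor? U q) x srcx
        (neighbor (ℕ.<-≤-trans (lift<ι srcq) (max _ (source⁺ S srcq) (ι-mono-< srcq))) x<b crosses)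
        fresh lifts covers
      where
      b : Fin m
      b = partner U q

      snkb : IsSink U b
      snkb = partner-of-source U srcq

      neighbor : ∀ {y} → lift q < y → y < ι b → ι b < partner T y → IsRightNeighbor T (lift q) y
      neighbor {y} q<y y<b b<y′ =
        q<y , subst (y <_) (sym (partner-lift q)) y<b ,
        subst (_< partner T y) (sym (partner-lift q)) b<y′

      compare : ∀ {r} → IsSource U r → r < b ⊎ b < r
      compare {r} srcr with <-cmp r b
      ... | tri< r<b _ _  = inj₁ r<b
      ... | tri≈ _ refl _ = contradiction snkb (source-not-sink U srcr)
      ... | tri> _ _ b<r  = inj₂ b<r

      -- Otherwise `ι r` would be a source strictly between `x` and `ι b`, against the maximality of
      -- `x`.
      not-before : ∀ {r} → IsSource U r → lift r ≡ x → ¬ r < b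
      not-before srcr refl r<b = ℕ.<⇒≱ (lift<ι srcr) (max _ (source⁺ S srcr) (ι-mono-< r<b))

      -- Either `x` is `c`, whose sink is the end, or `x` is the lift of some `r` after `b`, whose
      -- sink comes later still.
      crosses : ι b < partner T x
      crosses with x ≟ c
      ... | yes refl = subst (ι b <_) (sym (partner-involutive T end)) ι<end
      ... | no  x≢c with lift-surjective srcx x≢c
      ...   | r , srcr , refl with compare srcr
      ...     | inj₁ r<b = contradiction r<b (not-before srcr refl)
      ...     | inj₂ b<r = subst (ι b <_) (sym (partner-lift r)) (ι-mono-< (ℕ.<-trans b<r srcr))

      fresh : ∀ {r} → IsSource U r → IsRightNeighbor U q r → lift r ≢ x
      fresh srcr (_ , r<b , _) eq = not-before srcr eq r<b

      lifts : ∀ {r} → IsSource U r → IsRightNeighbor U q r → IsRightNeighbor T (lift q) (lift r)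
      lifts {r} srcr (q<r , r<b , b<r′) = neighbor
        (lift-mono-< srcq srcr q<r)
        (ℕ.<-trans (lift<ι srcr) (ι-mono-< r<b))
        (subst (ι b <_) (sym (partner-lift r)) (ι-mono-< b<r′))

      covers : ∀ {y} → IsSource T y → IsRightNeighbor T (lift q) y →
               y ≡ x ⊎ ∃[ r ] (IsSource U r × IsRightNeighbor U q r × y ≡ lift r)
      covers {y} srcy (q<y , y<b′ , b<y′) with y ≟ c
      ... | yes refl = inj₁ (toℕ-injective (ℕ.≤-antisym
              (max _ srcy (subst (y <_) (partner-lift q) y<b′)) (≤c srcx)))
      ... | no  y≢c with lift-surjective srcy y≢c
      ...   | r , srcr , refl with compare srcr
      ...     | inj₁ r<b = inj₂ (r , srcr ,
                  (lift-cancel-< srcq srcr q<y , r<b ,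
                   ι-cancel-< (subst₂ _<_ (partner-lift q) (partner-lift r) b<y′)) , refl)
      -- No source lies strictly between `lift r` and `ι r`, while `ι b` does; so `lift r` is the
      -- last source before `ι b`, which is `x`.
      ...     | inj₂ b<r = inj₁ (toℕ-injective (ℕ.≤-antisym
                  (max _ srcy (subst (lift r <_) (partner-lift q) y<b′))
                  (≤lift srcr _ srcx (ℕ.<-trans x<b (ι-mono-< b<r)))))

  -- Lifting a chord adds one right neighbor and one later source, so a violation at level `j + 1`
  -- in `T` descends to one at level `j` in `U`.
  Shift-KTerminal⁺ : ∀ {k} → KTerminal U k → KTerminal T (suc k)
  Shift-KTerminal⁺ kt (suc j) _ (s≤s j≤k) x d srcx (srcd , count) x<d terminal
    with lift-surjective srcx (λ { refl → ℕ.<⇒≱ x<d (≤c srcd) })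
  ... | q , srcq , refl = impossible j j≤k count (subst (_≤ j) (right-neighbors srcq) terminal)
    where
    impossible : ∀ j → j ≤ _ → suc (length (filter (d <?_) (sources T))) ≡ suc j →
                 ¬ suc (length (rightNeighbors U q)) ≤ j
    -- Only positive `j` arise: a lifted chord has a right neighbor and is never 1-terminal.
    impossible (suc j) j≤k count (s≤s few) with d ≟ c
    ... | no d≢c with lift-surjective srcd d≢c
    ...   | e , srce , refl =
      kt (suc j) (s≤s z≤n) j≤k q e srcq
        (srce , trans (sym (later-sources srce)) (ℕ.suc-injective count))
        (lift-cancel-< srcq srce x<d) few
    -- Nothing comes after `c`, whereas `count` asks for at least one later source.
    impossible (suc j) j≤k count (s≤s few) | yes refl =
      contradiction (trans (sym (none-after-last T c λ x → ≤c {x})) (ℕ.suc-injective count)) λ ()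

  Shift-KTerminal⁻ : ∀ {k} → KTerminal T (suc k) → KTerminal U k
  Shift-KTerminal⁻ kt (suc j) _ j≤k q e srcq (srce , count) q<e terminal =
    kt (suc (suc j)) (s≤s z≤n) (s≤s j≤k) (lift q) (lift e) (lift-source srcq)
      (lift-source srce , cong suc (trans (later-sources srce) count))
      (lift-mono-< srcq srce q<e)
      (subst (_≤ suc j) (sym (right-neighbors srcq)) (s≤s terminal))

-- ψ is a shift

-- Membership of `x` makes the list nonempty, so the default `d` is never returned.
last-maximum : ∀ {m} {d x : Fin m} {xs} → AllPairs _<_ xs → x ∈ xs →
               fromMaybe d (last xs) ∈ xs × (∀ {y} → y ∈ xs → y Fin.≤ fromMaybe d (last xs))
last-maximum {xs = _ ∷ []} _ _ = here refl , λ { (here refl) → ℕ.≤-refl }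
last-maximum {xs = _ ∷ _ ∷ _} (x< ∷ xs<) _ with last-maximum xs< (here refl)
... | l∈ , ≤l = there l∈ , λ { (here refl) → ℕ.<⇒≤ (All.lookup x< l∈) ; (there y∈) → ≤l y∈ }

-- `relabel` computes only when its length proof is `refl`; `cast` allows the equation to be stated
-- for an arbitrary proof.
lookup-relabel : ∀ {m m′} (T : PerfectMatching m) ps (len : length ps ≡ m′) ps!
                 (closed : ∀ {p} → p ∈ ps → partner T p ∈ ps) i →
                 lookup ps (cast (sym len) (partner (relabel T ps len ps! closed) i)) ≡
                 partner T (lookup ps (cast (sym len) i))
lookup-relabel T ps refl ps! closed i
  rewrite cast-is-id refl i
        | cast-is-id refl (index (closed (∈-lookup {xs = ps} i))) =
  sym (lookup-index (closed (∈-lookup i)))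

lookup-pointwise : ∀ {A B : Set} {R : A → B → Set} {m xs} {g : Fin m → B} →
                   Pointwise R xs (tabulate g) → (len : length xs ≡ m) → ∀ i →
                   R (lookup xs (cast (sym len) i)) (g i)
lookup-pointwise {m = suc m} (r ∷ _)  _   zero    = r
lookup-pointwise {m = suc m} (_ ∷ rs) len (suc i) = lookup-pointwise rs (ℕ.suc-injective len) i

-- 1-terminality enters as `crossed`: every chord except the last has a right neighbor.
module _ {m : ℕ} (T : PerfectMatching (suc (suc m))) (c : Fin (suc (suc m)))
         (c-source : IsSource T c) (≤c : ∀ {x} → IsSource T x → x Fin.≤ c)
         (crossed : ∀ {s} → IsSource T s → s ≢ c → ∃[ x ] (IsSource T x × IsRightNeighbor T s x))
  where

  private
    -- A right neighbor has a later sink, so the chord ending at the end point has none and must be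
    -- the last chord.
    partner-c : partner T c ≡ end
    partner-c with partner T end ≟ c
    ... | yes eq = trans (cong (partner T) (sym eq)) (partner-involutive T end)
    ... | no e′≢c with crossed (partner-of-sink T (end-sink T)) e′≢c
    ...   | x , _ , _ , _ , e<x′ =
      contradiction (subst (_< partner T x) (partner-involutive T end) e<x′) ¬end<

    final-predecessor : Predecessor (IsSource T) c end
    final-predecessor = c-source , subst (c <_) partner-c c-source , λ _ src _ → ≤c src

    -- No group is cut short by the sink of its own chord, except the last one.
    predecessor-partner : ∀ {s t} → Predecessor (IsSource T) s t → t ≢ end → t < partner T s
    predecessor-partner {s} {t} (src , s<t , max) t≢end with s ≟ c
    ... | yes refl = subst (t <_) (sym partner-c) (≤∧≢⇒< (≤fromℕ t) t≢end)
    ... | no  s≢c with crossed src s≢c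
    -- The right neighbor `x` is a source after `s`, hence not before `t`, and it precedes the sink
    -- of `s`.
    ...   | x , srcx , s<x , x<s′ , _ =
      ℕ.≤-<-trans (ℕ.≮⇒≥ λ x<t → ℕ.<⇒≱ s<x (max x srcx x<t)) x<s′

    keep : List (Fin (suc (suc m))) → List (Fin (suc (suc m)))
    keep ps = delete (partner T c) (delete c ps)

    keep-accept : ∀ {p ps} → p ≢ c → p ≢ end → keep (p ∷ ps) ≡ p ∷ keep ps
    keep-accept p≢c p≢end = trans
      (cong (delete _) (filter-accept (λ q → ¬? (q ≟ c)) p≢c))
      (filter-accept (λ q → ¬? (q ≟ partner T c)) λ eq → p≢end (trans eq partner-c))

    keep-last : keep (c ∷ end ∷ []) ≡ []
    keep-last = trans
      (cong (delete (partner T c)) (trans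
        (filter-reject (λ q → ¬? (q ≟ c)) {xs = end ∷ []} (λ c≢c → c≢c refl))
        (filter-accept (λ q → ¬? (q ≟ c)) {x = end} {xs = []} λ { refl → ¬end< c-source })))
      (filter-reject (λ q → ¬? (q ≟ partner T c)) {x = end} {xs = []} λ e≢c′ → e≢c′ (sym partner-c))

    -- `x` is the endpoint that ends up in the place of `y`: a sink stays, and the place of a source
    -- is taken by the preceding source, whose group ends there.
    data Moved (x y : Fin (suc (suc m))) : Set where
      sink   : IsSink T y → x ≡ y → Moved x y
      source : IsSource T y → Predecessor (IsSource T) x y → Moved x y

    prepend : ∀ {p ps y ys} → p ≢ c → p ≢ end → Moved p y → Pointwise Moved (keep ps) ys →
              Pointwise Moved (keep (p ∷ ps)) (y ∷ ys)
    prepend {ps = ps} {y} {ys} p≢c p≢end p→y ps→ys =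
      subst (λ qs → Pointwise Moved qs (y ∷ ys)) (sym (keep-accept {ps = ps} p≢c p≢end)) (p→y ∷ ps→ys)

    carry-sink : ∀ {s p ps} → IsSink T p → p ≢ partner T s →
                 carrySource T s (p ∷ ps) ≡ p ∷ carrySource T s ps
    carry-sink {s} {p} snk p≢s′
      rewrite dec-true (isSink? T p ×-dec ¬? (p ≟ partner T s)) (snk , p≢s′) = refl

    carry-source : ∀ {s p ps} → IsSource T p →
                   carrySource T s (p ∷ ps) ≡ s ∷ carrySource T p ps
    carry-source {s} {p} src
      rewrite dec-false (isSink? T p ×-dec ¬? (p ≟ partner T s)) (source-not-sink T src ∘ proj₁)
            | dec-true (isSource? T p) src = refl

    carry-end : carrySource T c (end ∷ []) ≡ c ∷ end ∷ []
    carry-end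
      rewrite dec-false (isSink? T end ×-dec ¬? (end ≟ partner T c)) (λ r → proj₂ r (sym partner-c))
            | dec-false (isSource? T end) (λ src → ¬end< src) = refl

    -- `g` lists the consecutive points still to be read, and `s` is the carried source, the last
    -- one before `g zero`. Every point before the end puts down exactly one endpoint: a sink
    -- itself, a source the one carried so far.
    carried : ∀ k (g : Fin (suc k) → Fin (suc (suc m))) {s} →
              (∀ i → toℕ (g (suc i)) ≡ suc (toℕ (g (inject₁ i)))) → g (fromℕ k) ≡ end →
              Predecessor (IsSource T) s (g zero) →
              Pointwise Moved (keep (carrySource T s (tabulate g))) (tabulate (g ∘ inject₁))
    carried ℕ.zero g {s} _ g-end pred
      -- With only the end left, the carried source is `c`; it is put down before its sink, and both
      -- are deleted.
      with refl ← predecessor-unique (subst (Predecessor (IsSource T) s) g-end pred) final-predecessor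
      rewrite g-end | carry-end | keep-last = []
    carried (suc k) g {s} steps g-end pred@(_ , s<p , max) = go (source-or-sink T (g zero))
      where
      g0<g1 : g zero < g (suc zero)
      g0<g1 = ℕ.≤-reflexive (sym (steps zero))

      <g1⇒≤g0 : ∀ {x} → x < g (suc zero) → x Fin.≤ g zero
      <g1⇒≤g0 {x} x<g1 = ℕ.s≤s⁻¹ (subst (suc (toℕ x) ≤_) (steps zero) x<g1)

      g0≢end : g zero ≢ end
      g0≢end eq = ¬end< (subst (_< g (suc zero)) eq g0<g1)

      go : IsSource T (g zero) ⊎ IsSink T (g zero) →
           Pointwise Moved (keep (carrySource T s (tabulate g))) (tabulate (g ∘ inject₁))
      go (inj₁ src) = subst (λ ps → Pointwise Moved (keep ps) (tabulate (g ∘ inject₁)))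
        (sym (carry-source {ps = tabulate (g ∘ suc)} src))
        -- The source put down survives the deletion: a later source has just been read, so it is
        -- not `c`.
        (prepend (λ { refl → ℕ.<⇒≱ s<p (≤c src) }) (λ { refl → ¬end< s<p }) (source src pred)
          (carried k (g ∘ suc) (steps ∘ suc) g-end (src , g0<g1 , λ _ _ → <g1⇒≤g0)))
      go (inj₂ snk) = subst (λ ps → Pointwise Moved (keep ps) (tabulate (g ∘ inject₁)))
        -- The sink read lies before the sink of `s`, so it does not close the group.
        (sym (carry-sink {ps = tabulate (g ∘ suc)} snk
          (ℕ.<⇒≢ (predecessor-partner pred g0≢end) ∘ cong toℕ)))
        (prepend (λ eq → source-not-sink T (subst (IsSource T) (sym eq) c-source) snk) g0≢end (sink snk refl)
          (carried k (g ∘ suc) (steps ∘ suc) g-end (proj₁ pred , ℕ.<-trans s<p g0<g1 , max′)))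
        where
        max′ : ∀ x → IsSource T x → x < g (suc zero) → x Fin.≤ s
        max′ x srcx x<g1 with ≤-split (<g1⇒≤g0 x<g1)
        ... | inj₁ x<g0 = max x srcx x<g0
        ... | inj₂ refl = contradiction snk (source-not-sink T srcx)

    -- The first point is picked up before anything is put down, which causes the offset of one in
    -- `ι`.
    moved : Pointwise Moved (keep (moveSources T (allFin _))) (tabulate ι)
    moved rewrite dec-true (isSource? T zero) (zero-source T) =
      carried m suc (λ i → cong suc (cong suc (sym (toℕ-inject₁ i)))) refl
        (zero-source T , s≤s z≤n , λ _ _ → ℕ.s≤s⁻¹)

    -- `f` names the original endpoint at each position of the new order. No source passes its own
    -- sink, so the roles of source and sink in `U` can be read off from `T` at `ι q`.
    moved⇒Shift : (U : PerfectMatching m) (f : Fin m → Fin (suc (suc m))) →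
                  (∀ q → f (partner U q) ≡ partner T (f q)) → (∀ q → Moved (f q) (ι q)) → Shift T U
    moved⇒Shift U f f-partner f-moved = record
      { source⁺   = ⇒source
      ; source⁻   = source⇒
      ; innerSink = innerSink′
      ; finalSink = subst (λ s → Predecessor (IsSource T) s end)
          (trans (sym (partner-involutive T c)) (cong (partner T) partner-c)) final-predecessor
      }
      where
      at-source : ∀ {q} → IsSource T (ι q) → Predecessor (IsSource T) (f q) (ι q)
      at-source {q} src with f-moved q
      ... | source _ pred = pred
      ... | sink snk _    = contradiction snk (source-not-sink T src)

      at-sink : ∀ {q} → IsSink T (ι q) → f q ≡ ι q
      at-sink {q} snk with f-moved q
      ... | source src _ = contradiction snk (source-not-sink T src)
      ... | sink _ eq    = eq

      source⇒ : ∀ {q} → IsSource T (ι q) → IsSource U q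
      source⇒ {q} src with at-source src | f-moved (partner U q)
      ... | pred , _ | source _ (src′ , _) =
        contradiction (partner-of-source T pred) (source-not-sink T (subst (IsSource T) (f-partner q) src′))
      -- The partner of `f q` is a sink that kept its place, and `ι q` lies before it because the
      -- group of `f q` ends earlier.
      ... | _ | sink _ eq = ι-cancel-< (subst (ι q <_) (trans (sym (f-partner q)) eq)
        (predecessor-partner (at-source src) ι≢end))

      sink⇒ : ∀ {q} → IsSink T (ι q) → IsSink U q
      sink⇒ {q} snk with f-moved (partner U q)
      ... | source src _ = subst (partner U q <_) (partner-involutive U q) (source⇒ src)
      ... | sink snk′ eq = contradiction snk′ (source-not-sink T (subst (IsSource T)
        (trans (cong (partner T) (sym (at-sink snk))) (trans (sym (f-partner q)) eq))
        (partner-of-sink T snk)))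

      ⇒source : ∀ {q} → IsSource U q → IsSource T (ι q)
      ⇒source {q} src with source-or-sink T (ι q)
      ... | inj₁ src′ = src′
      ... | inj₂ snk  = contradiction (sink⇒ snk) (source-not-sink U src)

      innerSink′ : ∀ {q} → IsSink U q → Predecessor (IsSource T) (partner T (ι q)) (ι (partner U q))
      innerSink′ {q} snk =
        subst (λ s → Predecessor (IsSource T) s (ι (partner U q)))
          (trans (f-partner q) (cong (partner T) (at-sink snkT)))
          (at-source (⇒source (partner-of-sink U snk)))
        where
        snkT : IsSink T (ι q)
        snkT = not-source⇒sink T λ src → source-not-sink U (source⇒ src) snk

  relabel-Shift : ∀ len ps!
    (closed : ∀ {p} → p ∈ keep (moveSources T (allFin _)) → partner T p ∈ keep (moveSources T (allFin _))) →
    Shift T (relabel T (keep (moveSources T (allFin _))) len ps! closed)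
  relabel-Shift len ps! closed = moved⇒Shift _ _
    (lookup-relabel T (keep (moveSources T (allFin _))) len ps! closed) (lookup-pointwise moved len)

-- `2 * suc n` does not reduce to `suc (suc (2 * n))`; with a variable `M` in its place, the
-- equation can be matched with `refl`.
relabel-Shift-subst : ∀ {m M} (e : M ≡ suc (suc m)) (T : PerfectMatching M) (c : Fin M)
  (c-source : IsSource T c) (≤c : ∀ {x} → IsSource T x → x Fin.≤ c)
  (crossed : ∀ {s} → IsSource T s → s ≢ c → ∃[ x ] (IsSource T x × IsRightNeighbor T s x))
  len ps! (closed : ∀ {p} → p ∈ delete (partner T c) (delete c (moveSources T (allFin M))) →
                    partner T p ∈ delete (partner T c) (delete c (moveSources T (allFin M)))) →
  Shift (subst PerfectMatching e T)
    (relabel T (delete (partner T c) (delete c (moveSources T (allFin M)))) len ps! closed)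
relabel-Shift-subst refl = relabel-Shift

-- Transport along equations between sizes

subst-≈⁺ : ∀ {m m′} (e : m ≡ m′) {T U : PerfectMatching m} → T ≈ U →
           subst PerfectMatching e T ≈ subst PerfectMatching e U
subst-≈⁺ refl T≈U = T≈U

subst-≈⁻ : ∀ {m m′} (e : m ≡ m′) {T U : PerfectMatching m} →
           subst PerfectMatching e T ≈ subst PerfectMatching e U → T ≈ U
subst-≈⁻ refl T≈U = T≈U

subst-sym-≈ : ∀ {m m′} (e : m ≡ m′) {U : PerfectMatching m′} →
              subst PerfectMatching e (subst PerfectMatching (sym e) U) ≈ U
subst-sym-≈ refl _ = refl

subst-KTerminal : ∀ {m m′} (e : m ≡ m′) {T : PerfectMatching m} {k} →
                   KTerminal T k → KTerminal (subst PerfectMatching e T) k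
subst-KTerminal refl kt = kt

ψ-Shift : ∀ n {k} (T : ChordDiagram (suc n)) → KTerminal T (suc k) →
          Shift (subst PerfectMatching (*-suc 2 n) T) (ψ n T)
ψ-Shift n T kt = relabel-Shift-subst (*-suc 2 n) T c c-source ≤c crossed
  (ψ-points-length n T) (ψ-points-unique n T) (ψ-points-closed n T)
  where
  c : Fin (2 * suc n)
  c = lastSource n T

  c-maximum : c ∈ sources T × (∀ {y} → y ∈ sources T → y Fin.≤ c)
  c-maximum = last-maximum (sources-increasing T) (∈-sources⁺ T (zero-source T))

  c-source : IsSource T c
  c-source = ∈-sources⁻ T (proj₁ c-maximum)

  ≤c : ∀ {x} → IsSource T x → x Fin.≤ c
  ≤c src = proj₂ c-maximum (∈-sources⁺ T src)

  crossed : ∀ {s} → IsSource T s → s ≢ c → ∃[ x ] (IsSource T x × IsRightNeighbor T s x)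
  crossed {s} src s≢c = go (rightNeighbors T s) refl
    where
    go : ∀ xs → rightNeighbors T s ≡ xs → ∃[ x ] (IsSource T x × IsRightNeighbor T s x)
    -- A chord before `c` without right neighbors would violate terminality at level 1.
    go [] eq = contradiction (ℕ.≤-reflexive (cong length eq))
      (kt 1 ℕ.≤-refl (s≤s z≤n) s c src (c-source , cong suc (none-after-last T c λ x → ≤c {x}))
        (≤∧≢⇒< (≤c src) s≢c))
    go (x ∷ _) eq with ∈-filter⁻ (isRightNeighbor? T s) {xs = sources T} (subst (x ∈_) (sym eq) (here refl))
    ... | x∈ , rn = x , ∈-sources⁻ T x∈ , rn

-- The bijection obtained from shifts

module _ {n k : ℕ} (e : 2 * suc n ≡ suc (suc (2 * n))) (φ : ChordDiagram (suc n) → ChordDiagram n)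
         (φ-Shift : ∀ T → KTerminal T (suc k) → Shift (subst PerfectMatching e T) (φ T))
  where

  private
    φ-cong : ∀ T T′ → KTerminal T (suc k) → KTerminal T′ (suc k) → T ≈ T′ → φ T ≈ φ T′
    φ-cong T T′ kt kt′ T≈T′ = Shift-functional (φ-Shift T kt) (φ-Shift T′ kt′) (subst-≈⁺ e T≈T′)

    φ-injective : ∀ T T′ → KTerminal T (suc k) → KTerminal T′ (suc k) → φ T ≈ φ T′ → T ≈ T′
    φ-injective T T′ kt kt′ eq =
      subst-≈⁻ e (Shift-injective (φ-Shift T kt) (φ-Shift T′ kt′) eq)

    φ-KTerminal : ∀ T → KTerminal T (suc k) → KTerminal (φ T) k
    φ-KTerminal T kt = Shift-KTerminal⁻ (φ-Shift T kt) (subst-KTerminal e kt)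

    -- Up to transport, `T` is `unshift U`; it is related by `Shift` to both `φ T` and `U`, and the
    -- relation is functional.
    φ-preimage : ∀ U → KTerminal U k → ∃[ T ] (KTerminal T (suc k) × φ T ≈ U)
    φ-preimage U ktU = T , ktT , Shift-functional (φ-Shift T ktT) (unshift-Shift U)
      (subst-sym-≈ e)
      where
      T : ChordDiagram (suc n)
      T = subst PerfectMatching (sym e) (unshift U)

      ktT : KTerminal T (suc k)
      ktT = subst-KTerminal (sym e) (Shift-KTerminal⁺ (unshift-Shift U) ktU)

  Shift-bijection : Bijection (KTerminalDiagrams (suc k) (suc n)) (KTerminalDiagrams k n)
  Shift-bijection = record
    { to        = λ (T , kt) → φ T , φ-KTerminal T kt
    ; cong      = λ { {T , kt} {T′ , kt′} → φ-cong T T′ kt kt′ }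
    ; bijective = (λ { {T , kt} {T′ , kt′} → φ-injective T T′ kt kt′ }) , surjective
    }
    where
    surjective : ∀ (y : KTerminalDiagram k n) →
                 Σ[ x ∈ KTerminalDiagram (suc k) (suc n) ]
                   (∀ {z : KTerminalDiagram (suc k) (suc n)} → proj₁ z ≈ proj₁ x → φ (proj₁ z) ≈ proj₁ y)
    surjective (U , ktU) with T , kt , φT≈U ← φ-preimage U ktU =
      (T , kt) , λ { {z , ktz} z≈T p → trans (φ-cong z T ktz kt z≈T p) (φT≈U p) }

proposition8p8 : (k n : ℕ) → 1 ≤ k → 2 ≤ suc n →
    Σ[ f ∈ Bijection (KTerminalDiagrams k (suc n)) (KTerminalDiagrams (k ∸ 1) n) ]
    (∀ T → proj₁ (Bijection.to f T) ≈ ψ n (proj₁ T))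
proposition8p8 (suc k) n _ _ = Shift-bijection (*-suc 2 n) (ψ n) (ψ-Shift n {k}) , λ _ _ → refl
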